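{- The logic $\mathcal{RPCH}^d$ is BP-algebraizable (algebraizable in the sense of Blok and Pigozzi) with the variety $\mathbb{RPCH}^d$ of regular pseudocomplemented dual Heyting algebras as its equivalent algebraic semantics.
   Context: Variety. $\mathbb{RPCH}^d$ consists of the algebras $\langle A,\vee,\wedge,{}^*,\leftarrow,0,1\rangle$ with bounded distributive lattice reduct in which $x^*$ is the largest $z$ with $x\wedge z=0$, $x\leftarrow y$ is the least $z$ with $y\le x\vee z$, and, with $x^+:=x\leftarrow1$, $(x\wedge x^+)\vee(y\vee y^*)\approx y\vee y^*$ holds. (These are the order-duals of regular dually pseudocomplemented Heyting algebras.) The language $\langle\vee,\wedge,\leftarrow,\sim,\bot,\top\rangle$ is interpreted with $\sim$ as ${}^*$, $\bot$ as $0$, $\top$ as $1$. Logic $\mathcal{RDPCH}$. Formulas are built from a countably infinite set of propositional variables in $\langle \vee,\wedge,\to,\sim,\bot,\top\rangle$. Abbreviations: $\alpha\to_H\beta:=\alpha\to(\alpha\wedge\beta)$; $\alpha\leftrightarrow_H\beta:=(\alpha\to_H\beta)\wedge(\beta\to_H\alpha)$; $\beta^\circ:=\beta\to\bot$. Axioms: (1) $\alpha\to_H(\alpha\vee\beta)$; (2) $\beta\to_H(\alpha\vee\beta)$; (3) $(\alpha\to_H\gamma)\to_H[(\beta\to_H\gamma)\to_H\{(\alpha\vee\beta)\to_H\gamma\}]$; (4) $(\alpha\wedge\beta)\to_H\alpha$; (5) $(\gamma\to_H\alpha)\to_H[(\gamma\to_H\beta)\to_H(\gamma\to_H(\alpha\wedge\beta))]$;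 (6) $\top$; (7) $\bot\to_H\alpha$; (8) $[(\alpha\wedge\beta)\to_H\gamma]\to_H[\alpha\to_H(\beta\to_H\gamma)]$; (9) $[\alpha\to_H(\beta\to_H\gamma)]\to_H[(\alpha\wedge\beta)\to_H\gamma]$; (10) $(\alpha\to_H\beta)\to_H[(\beta\to_H\alpha)\to_H((\alpha\to\gamma)\to_H(\beta\to\gamma))]$; (11) $(\alpha\to_H\beta)\to_H[(\beta\to_H\alpha)\to_H((\gamma\to\beta)\to_H(\gamma\to\alpha))]$; (12) $\top\to_H\sim\bot$; (13) $\sim\top\to_H\bot$; (14) $\sim(\alpha\wedge\beta)\to_H(\sim\alpha\vee\sim\beta)$; (15) $(\alpha\wedge\beta)\to\alpha$; (16) $\sim\bot\to_H\top$; (17) $\sim\sim(\alpha\vee\beta)\leftrightarrow_H(\sim\sim\alpha\vee\sim\sim\beta)$; (18) $(\sim\sim\alpha\vee\alpha)\leftrightarrow_H\alpha$; (19) $\alpha\vee\sim\alpha$; ($\mathcal M_1$) $((\alpha\wedge\sim\alpha)\vee(\beta\vee\beta^\circ))\leftrightarrow_H(\beta\vee\beta^\circ)$. Rules: (MP) from $\varphi$ and $\varphi\to_H\gamma$ deduce $\gamma$; (CP) from $\varphi\to_H\gamma$ deduce $\sim\gamma\to_H\sim\varphi$. Logic $\mathcal{RPCH}^d$. It is obtained by dualizing the axioms and rules of $\mathcal{RDPCH}$: in every axiom and rule (with abbreviations expanded) interchange $\vee$ and $\wedge$, interchange $\bot$ and $\top$, replace $\to$ by $\leftarrow$, and leave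 $\sim$ unchanged. (So $\alpha\to_H\beta$ becomes $\alpha\leftarrow(\alpha\vee\beta)$, and e.g. axiom (6) becomes $\bot$.) The consequence relation is given by finite derivations using elements of $\Gamma$, substitution instances of axioms, and instances of rules. Algebraizability. For a class $\mathbb K$ of algebras, $\Delta\models_{\mathbb K}\alpha\approx\beta$ means: in every $\mathbf A\in\mathbb K$, every valuation satisfying all identities in $\Delta$ satisfies $\alpha\approx\beta$. A class $\mathbb K$ is an equivalent algebraic semantics of a logic $\vdash$ if there are finitely many identities $\delta_i(p)\approx\epsilon_i(p)$ in one variable and finitely many formulas $\Delta_j(p,q)$ such that: (A) for all $\Gamma\cup\{\varphi\}$, $\Gamma\vdash\varphi$ iff $\{\delta_i(\psi)\approx\epsilon_i(\psi): i,\ \psi\in\Gamma\}\models_{\mathbb K}\delta_k(\varphi)\approx\epsilon_k(\varphi)$ for all $k$; (B) for all formulas $\varphi,\psi$, $\varphi\approx\psi$ and the set $\{\delta_i(\Delta_j(\varphi,\psi))\approx\epsilon_i(\Delta_j(\varphi,\psi)):i,j\}$ are $\models_{\mathbb K}$-consequences of each other. A logic is BP-algebraizable if it has an equivalent algebraic semantics. -}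

module Defs where

open import Level using (Level; _⊔_; 0ℓ) renaming (suc to lsuc)
open import Algebra.Core using (Op₁; Op₂)
open import Algebra.Definitions using (Congruent₁; Congruent₂)
open import Algebra.Lattice.Structures using (IsDistributiveLattice)
open import Data.Fin.Base using (Fin; zero; suc)
open import Data.List.Base using (List; []; _∷_; map)
open import Data.List.Membership.Propositional using () renaming (_∈_ to _∈ˡ_)
open import Data.List.Relation.Unary.All using (All)
open import Data.Nat.Base using (ℕ)
open import Data.Product.Base using (∃-syntax; _×_; _,_)
open import Function.Bundles using (_⇔_)
open import Relation.Binary.Core using (Rel)
open import Relation.Binary.Definitions using (Maximum; Minimum)
open import Relation.Binary.PropositionalEquality.Core using (_≡_)
open import Relation.Binary.Structures using (IsEquivalence)
open import Relation.Unary using (Pred; _∈_; ｛_｝)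
import Relation.Binary.Construct.NaturalOrder.Left as NaturalOrder

private variable
  V W : Set
  c ℓ k g : Level

module RDPCH where

  infixr 10 ∼_
  infix  10 _°
  infixr 9 _∧_
  infixr 8 _∨_
  infixr 7 _⟶_ _⟶ᴴ_
  infix  6 _⟷ᴴ_

  data Formula (V : Set) : Set where
    var         : V → Formula V
    _∨_ _∧_ _⟶_ : Formula V → Formula V → Formula V
    ∼_          : Formula V → Formula V
    ⊥ ⊤         : Formula V

  _⟶ᴴ_ _⟷ᴴ_ : Formula V → Formula V → Formula V
  α ⟶ᴴ β = α ⟶ (α ∧ β)
  α ⟷ᴴ β = (α ⟶ᴴ β) ∧ (β ⟶ᴴ α)

  _° : Formula V → Formula V
  β ° = β ⟶ ⊥

-- Axioms and rules are formulas over the variables ℕ; their instances are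
-- obtained by substitution (see _⟨_⟩⊢_ below). A rule is a list of premises
-- with a conclusion.
record HilbertSystem (Fm : Set) : Set where
  field
    axioms : List Fm
    rules  : List (List Fm × Fm)

open HilbertSystem public

module _ where
  open RDPCH

  private
    α β γ : Formula ℕ
    α = var 0
    β = var 1
    γ = var 2

  RDPCH-system : HilbertSystem (RDPCH.Formula ℕ)
  RDPCH-system .axioms =
      α ⟶ᴴ (α ∨ β)
    ∷ β ⟶ᴴ (α ∨ β)
    ∷ (α ⟶ᴴ γ) ⟶ᴴ ((β ⟶ᴴ γ) ⟶ᴴ ((α ∨ β) ⟶ᴴ γ))
    ∷ (α ∧ β) ⟶ᴴ α
    ∷ (γ ⟶ᴴ α) ⟶ᴴ ((γ ⟶ᴴ β) ⟶ᴴ (γ ⟶ᴴ (α ∧ β)))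
    ∷ ⊤
    ∷ ⊥ ⟶ᴴ α
    ∷ ((α ∧ β) ⟶ᴴ γ) ⟶ᴴ (α ⟶ᴴ (β ⟶ᴴ γ))
    ∷ (α ⟶ᴴ (β ⟶ᴴ γ)) ⟶ᴴ ((α ∧ β) ⟶ᴴ γ)
    ∷ (α ⟶ᴴ β) ⟶ᴴ ((β ⟶ᴴ α) ⟶ᴴ ((α ⟶ γ) ⟶ᴴ (β ⟶ γ)))
    ∷ (α ⟶ᴴ β) ⟶ᴴ ((β ⟶ᴴ α) ⟶ᴴ ((γ ⟶ β) ⟶ᴴ (γ ⟶ α)))
    ∷ ⊤ ⟶ᴴ ∼ ⊥
    ∷ ∼ ⊤ ⟶ᴴ ⊥
    ∷ ∼ (α ∧ β) ⟶ᴴ (∼ α ∨ ∼ β)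
    ∷ (α ∧ β) ⟶ α
    ∷ ∼ ⊥ ⟶ᴴ ⊤
    ∷ ∼ ∼ (α ∨ β) ⟷ᴴ (∼ ∼ α ∨ ∼ ∼ β)
    ∷ (∼ ∼ α ∨ α) ⟷ᴴ α
    ∷ α ∨ ∼ α
    ∷ ((α ∧ ∼ α) ∨ (β ∨ β °)) ⟷ᴴ (β ∨ β °)
    ∷ []
  RDPCH-system .rules =
      (α ∷ (α ⟶ᴴ γ) ∷ [] , γ)
    ∷ ((α ⟶ᴴ γ) ∷ [] , ∼ γ ⟶ᴴ ∼ α)
    ∷ []

module RPCHᵈ where

  infixr 7 _∧_
  infixr 6 _∨_
  infixr 5 _←_
  infixr 8 ∼_

  data Formula (V : Set) : Set where
    var         : V → Formula V
    _∨_ _∧_ _←_ : Formula V → Formula V → Formula V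
    ∼_          : Formula V → Formula V
    ⊥ ⊤         : Formula V

  dual : RDPCH.Formula V → Formula V
  dual (RDPCH.var x)   = var x
  dual (φ RDPCH.∨ ψ)   = dual φ ∧ dual ψ
  dual (φ RDPCH.∧ ψ)   = dual φ ∨ dual ψ
  dual (φ RDPCH.⟶ ψ)   = dual φ ← dual ψ
  dual (RDPCH.∼ φ)     = ∼ dual φ
  dual RDPCH.⊥         = ⊤
  dual RDPCH.⊤         = ⊥

  infixl 9 _[_]

  _[_] : Formula V → (V → Formula W) → Formula W
  var x   [ σ ] = σ x
  (φ ∨ ψ) [ σ ] = (φ [ σ ]) ∨ (ψ [ σ ])
  (φ ∧ ψ) [ σ ] = (φ [ σ ]) ∧ (ψ [ σ ])
  (φ ← ψ) [ σ ] = (φ [ σ ]) ← (ψ [ σ ])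
  (∼ φ)   [ σ ] = ∼ (φ [ σ ])
  ⊥       [ σ ] = ⊥
  ⊤       [ σ ] = ⊤

open RPCHᵈ using (Formula; dual; _[_])

Fm : Set
Fm = Formula ℕ

dualSystem : HilbertSystem (RDPCH.Formula ℕ) → HilbertSystem Fm
dualSystem S .axioms = map dual (S .axioms)
dualSystem S .rules  = map (λ (ps , q) → map dual ps , dual q) (S .rules)

infix 3 _⟨_⟩⊢_

data _⟨_⟩⊢_ (Γ : Pred Fm g) (S : HilbertSystem Fm) : Fm → Set g where
  premise : ∀ {φ} → φ ∈ Γ → Γ ⟨ S ⟩⊢ φ
  axiom   : ∀ {φ} → φ ∈ˡ S .axioms → (σ : ℕ → Fm) → Γ ⟨ S ⟩⊢ φ [ σ ]
  rule    : ∀ {ps q} → (ps , q) ∈ˡ S .rules → (σ : ℕ → Fm) →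
            All (λ p → Γ ⟨ S ⟩⊢ p [ σ ]) ps → Γ ⟨ S ⟩⊢ q [ σ ]

infix 3 _⊢_

_⊢_ : Pred Fm g → Fm → Set g
Γ ⊢ φ = Γ ⟨ dualSystem RDPCH-system ⟩⊢ φ

record Algebra (c ℓ : Level) : Set (lsuc (c ⊔ ℓ)) where
  infixr 7 _∧_
  infixr 6 _∨_
  infixr 5 _←_
  infix  8 _*
  infix  4 _≈_
  field
    Carrier       : Set c
    _≈_           : Rel Carrier ℓ
    isEquivalence : IsEquivalence _≈_
    _∨_ _∧_ _←_   : Op₂ Carrier
    _*            : Op₁ Carrier
    0# 1#         : Carrier
    ∨-cong        : Congruent₂ _≈_ _∨_
    ∧-cong        : Congruent₂ _≈_ _∧_
    ←-cong        : Congruent₂ _≈_ _←_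
    *-cong        : Congruent₁ _≈_ _*

  open NaturalOrder _≈_ _∧_ public using (_≤_)

  ⟦_⟧ : Formula V → (V → Carrier) → Carrier
  ⟦ RPCHᵈ.var x ⟧ v   = v x
  ⟦ φ RPCHᵈ.∨ ψ ⟧ v   = ⟦ φ ⟧ v ∨ ⟦ ψ ⟧ v
  ⟦ φ RPCHᵈ.∧ ψ ⟧ v   = ⟦ φ ⟧ v ∧ ⟦ ψ ⟧ v
  ⟦ φ RPCHᵈ.← ψ ⟧ v   = ⟦ φ ⟧ v ← ⟦ ψ ⟧ v
  ⟦ RPCHᵈ.∼ φ ⟧ v     = ⟦ φ ⟧ v *
  ⟦ RPCHᵈ.⊥ ⟧ v       = 0#
  ⟦ RPCHᵈ.⊤ ⟧ v       = 1#

module _ {A : Set c} (_≤_ : Rel A ℓ) where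

  IsGreatest IsLeast : Pred A k → A → Set (c ⊔ ℓ ⊔ k)
  IsGreatest P m = P m × (∀ z → P z → z ≤ m)
  IsLeast    P m = P m × (∀ z → P z → m ≤ z)

record IsRPCHᵈ (A : Algebra c ℓ) : Set (c ⊔ ℓ) where
  open Algebra A
  field
    isDistributiveLattice : IsDistributiveLattice _≈_ _∨_ _∧_
    0-minimum             : Minimum _≤_ 0#
    1-maximum             : Maximum _≤_ 1#
    *-greatest            : ∀ x → IsGreatest _≤_ (λ z → x ∧ z ≈ 0#) (x *)
    ←-least               : ∀ x y → IsLeast _≤_ (λ z → y ≤ x ∨ z) (x ← y)

  _⁺ : Op₁ Carrier
  x ⁺ = x ← 1#

  field
    regular : ∀ x y → (x ∧ (x ⁺)) ∨ (y ∨ (y *)) ≈ y ∨ (y *)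

Identity : Set → Set
Identity V = Formula V × Formula V

_,_⊩_ : (A : Algebra c ℓ) → (V → Algebra.Carrier A) → Identity V → Set ℓ
A , v ⊩ (φ , ψ) = ⟦ φ ⟧ v ≈ ⟦ ψ ⟧ v
  where open Algebra A

infix 3 _⊨[_]_

_⊨[_]_ : Pred (Identity ℕ) g → Pred (Algebra c ℓ) k → Identity ℕ → Set (g ⊔ lsuc (c ⊔ ℓ) ⊔ k)
_⊨[_]_ {c = c} {ℓ = ℓ} Θ K e =
  (A : Algebra c ℓ) → A ∈ K → (v : ℕ → Algebra.Carrier A) →
  (∀ {d} → d ∈ Θ → A , v ⊩ d) → A , v ⊩ e

pair : Fm → Fm → Fin 2 → Fm
pair φ ψ zero       = φ
pair φ ψ (suc zero) = ψ

record IsEquivalentAlgebraicSemantics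
  (_⊢_ : Pred Fm g → Fm → Set g) (K : Pred (Algebra c ℓ) k) :
  Set (lsuc (g ⊔ c ⊔ ℓ) ⊔ k) where
  field
    definingIdentities  : List (Identity (Fin 1))
    equivalenceFormulas : List (Formula (Fin 2))

  _at_ : Identity (Fin 1) → Fm → Identity ℕ
  (δ , ε) at ψ = δ [ (λ _ → ψ) ] , ε [ (λ _ → ψ) ]

  _⟪_,_⟫ : Formula (Fin 2) → Fm → Fm → Fm
  D ⟪ φ , ψ ⟫ = D [ pair φ ψ ]

  translation : Pred Fm g → Pred (Identity ℕ) g
  translation Γ e =
    ∃[ d ] ∃[ ψ ] (d ∈ˡ definingIdentities × ψ ∈ Γ × e ≡ d at ψ)

  equivalence : Fm → Fm → Pred (Identity ℕ) 0ℓ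
  equivalence φ ψ e =
    ∃[ d ] ∃[ D ] (d ∈ˡ definingIdentities × D ∈ˡ equivalenceFormulas
                  × e ≡ d at (D ⟪ φ , ψ ⟫))

  field
    ⊢⇔⊨ :
      ∀ (Γ : Pred Fm g) φ →
      (Γ ⊢ φ) ⇔ (∀ {d} → d ∈ˡ definingIdentities → translation Γ ⊨[ K ] d at φ)
    ≈⇒equivalence :
      ∀ φ ψ {e} → e ∈ equivalence φ ψ → ｛ φ , ψ ｝ ⊨[ K ] e
    equivalence⇒≈ :
      ∀ φ ψ → equivalence φ ψ ⊨[ K ] (φ , ψ)

module Submission where

-- The dual of a formula is valid in an algebra iff its value is 0, so all reasoning takes place
-- in the reversed order, in which ∨ is the meet, ∧ the join and ← the Heyting implication.
-- With p ⇒ q := p ← (p ∨ q), the formula p ⇒ q is valid iff q ≤ p; hence p ≈ 0 is the defining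
-- identity and p ⇒ q, q ⇒ p are the equivalence formulas. Soundness is a computation in the
-- reversed Heyting algebra, and completeness follows from the Lindenbaum algebra of Γ under
-- φ ≼ ψ :⇔ Γ ⊢ φ ⇒ ψ, where ← agrees with ⇒ by axioms 10, 11 and 15, and the extremality of
-- ∼ follows from its equations.

open import Level using (Level; Lift; lift; lower; _⊔_)
open import Algebra.Core using (Op₁)
import Algebra.Lattice.Properties.DistributiveLattice as AlgDistributiveLattice
open import Data.Fin.Base using (Fin)
open import Data.Fin.Patterns using (0F; 1F)
open import Data.Fin using (#_)
open import Data.List.Base using ([]; _∷_; lookup)
open import Data.List.Membership.Propositional.Properties using (∈-lookup)
open import Data.List.Relation.Unary.All as All using (All; []; _∷_)
open import Data.List.Relation.Unary.Any using (here; there)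
open import Data.Nat.Base using (ℕ)
open import Data.Product.Base using (∃-syntax; _×_; _,_; proj₁; proj₂; swap)
open import Function.Base using (case_of_; flip)
open import Function.Bundles using (mk⇔)
open import Relation.Binary.Core using (Rel)
open import Relation.Binary.Lattice using (HeytingAlgebra; IsHeytingAlgebra; Lattice; Exponential)
import Relation.Binary.Lattice.Properties.DistributiveLattice as DistributiveLatticeProperties
import Relation.Binary.Lattice.Properties.HeytingAlgebra as HeytingProperties
import Relation.Binary.Lattice.Properties.JoinSemilattice as JoinProperties
import Relation.Binary.Lattice.Properties.Lattice as LatticeProperties
import Relation.Binary.Lattice.Properties.MeetSemilattice as MeetProperties
open import Relation.Binary.PropositionalEquality.Core as ≡ using (_≡_)
open import Relation.Binary.Structures using (IsEquivalence)
open import Relation.Unary using (Pred; _∈_)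
open import Defs
open RPCHᵈ using (Formula; _[_])

private variable
  c ℓ ℓ₁ ℓ₂ g : Level
  V W : Set

-- Heyting algebras with a regular dual pseudocomplement

module _ (H : HeytingAlgebra c ℓ₁ ℓ₂) where
  open HeytingAlgebra H

  record IsRegularDualPseudocomplement (_⁻ : Op₁ Carrier) : Set (c ⊔ ℓ₂) where
    field
      ⁻-complement : ∀ x → ⊤ ≤ x ∨ x ⁻
      ⁻-least      : ∀ {x z} → ⊤ ≤ x ∨ z → x ⁻ ≤ z
      regular      : ∀ x y → x ∧ x ⁻ ≤ y ∨ (y ⇨ ⊥)

module HeytingLemmas (H : HeytingAlgebra c ℓ₁ ℓ₂) where
  open HeytingAlgebra H public
  open HeytingProperties H public
    using (⇨-eval; distributiveLattice)
  open DistributiveLatticeProperties distributiveLattice public using (∨-distribˡ-∧)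
  open JoinProperties joinSemilattice public using (∨-monotonic; ∨-comm)
  open MeetProperties meetSemilattice public using (∧-monotonic; ∧-comm)

  _⇛_ : Carrier → Carrier → Carrier
  x ⇛ y = x ⇨ (x ∧ y)

  ⇛-exponential : Exponential _≤_ _∧_ _⇛_
  ⇛-exponential w x y =
    (λ w∧x≤y → transpose-⇨ (∧-greatest (x∧y≤y w x) w∧x≤y)) ,
    (λ w≤x⇛y → trans (transpose-∧ w≤x⇛y) (x∧y≤y x y))

  ⊤≤⇛ : ∀ {x y} → x ≤ y → ⊤ ≤ x ⇛ y
  ⊤≤⇛ {x} {y} x≤y = proj₁ (⇛-exponential ⊤ x y) (trans (x∧y≤y ⊤ x) x≤y)

  ⊤≤⇛⁻¹ : ∀ {x y} → ⊤ ≤ x ⇛ y → x ≤ y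
  ⊤≤⇛⁻¹ {x} {y} p = trans (∧-greatest (maximum x) refl) (proj₂ (⇛-exponential ⊤ x y) p)

  -- The axioms are phrased with `_⇛_`, which agrees with `_⇨_` in value but is a different term. As
  -- a second Heyting implication on the same lattice it inherits the laws of implication directly.
  ⇛-heytingAlgebra : HeytingAlgebra c ℓ₁ ℓ₂
  ⇛-heytingAlgebra = record
    { _⇨_              = _⇛_
    ; isHeytingAlgebra = record
      { isBoundedLattice = isBoundedLattice ; exponential = ⇛-exponential }
    }

module DualPseudocomplementLemmas
  (H : HeytingAlgebra c ℓ₁ ℓ₂) {_⁻ : Op₁ (HeytingAlgebra.Carrier H)}
  (isRegular : IsRegularDualPseudocomplement H _⁻) where

  open HeytingLemmas H
  open IsRegularDualPseudocomplement isRegular public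

  ⁻-antitone : ∀ {x y} → x ≤ y → y ⁻ ≤ x ⁻
  ⁻-antitone {x} x≤y = ⁻-least (trans (⁻-complement x) (∨-monotonic x≤y refl))

  ⁻⁻-deflationary : ∀ x → x ⁻ ⁻ ≤ x
  ⁻⁻-deflationary x = ⁻-least (trans (⁻-complement x) (reflexive (∨-comm x (x ⁻))))

  ⊤⁻≤⊥ : ⊤ ⁻ ≤ ⊥
  ⊤⁻≤⊥ = ⁻-least (x≤x∨y ⊤ ⊥)

  ⊤≤⊥⁻ : ⊤ ≤ ⊥ ⁻
  ⊤≤⊥⁻ = trans (⁻-complement ⊥) (∨-least (minimum _) refl)

  -- By leastness it suffices that `x ∧ y` joined with the right side is `⊤`. Distributivity splits
  -- this into one join for x and one for y, which lie above `x ∨ x ⁻` and `y ∨ y ⁻`.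
  ⁻-∧ : ∀ x y → (x ∧ y) ⁻ ≤ x ⁻ ∨ y ⁻
  ⁻-∧ x y = ⁻-least (trans
    (∧-greatest
      (trans (⁻-complement x) (∨-least (y≤x∨y _ _) (trans (x≤x∨y _ _) (x≤x∨y _ _))))
      (trans (⁻-complement y) (∨-least (y≤x∨y _ _) (trans (y≤x∨y _ _) (x≤x∨y _ _)))))
    (trans (reflexive (Eq.sym (∨-distribˡ-∧ _ x y))) (reflexive (∨-comm _ _))))

  -- Every z above (x ∨ y)⁻, x⁻⁻ and y⁻⁻ is ⊤: x ∨ z ≥ y⁻ ∨ y⁻⁻ = ⊤ and hence z ≥ x⁻ ∨ x⁻⁻ = ⊤.
  ⁻⁻-∨ : ∀ x y → (x ∨ y) ⁻ ⁻ ≤ x ⁻ ⁻ ∨ y ⁻ ⁻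
  ⁻⁻-∨ x y = ⁻-least (trans (⁻-complement (x ⁻)) (∨-least x⁻≤z (trans (x≤x∨y _ _) (y≤x∨y _ _))))
    where
    z = (x ∨ y) ⁻ ∨ (x ⁻ ⁻ ∨ y ⁻ ⁻)
    ⊤≤y∨[x∨z] : ⊤ ≤ y ∨ (x ∨ z)
    ⊤≤y∨[x∨z] = trans (⁻-complement (x ∨ y))
      (∨-least (∨-least (trans (x≤x∨y x z) (y≤x∨y y _)) (x≤x∨y y _))
               (trans (x≤x∨y _ _) (trans (y≤x∨y x z) (y≤x∨y y _))))
    x⁻≤z : x ⁻ ≤ z
    x⁻≤z = ⁻-least (trans (⁻-complement (y ⁻))
      (∨-least (⁻-least ⊤≤y∨[x∨z])
               (trans (y≤x∨y _ _) (trans (y≤x∨y _ _) (y≤x∨y x z)))))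

module _ (H : HeytingAlgebra c ℓ₁ ℓ₂) (_⁻ : Op₁ (HeytingAlgebra.Carrier H)) where
  open HeytingLemmas H

  -- If x ∨ z = ⊤ then x⁻ ≤ x⁻⁻⁻ ≤ (z ∨ x⁻)⁻⁻ = ((z ∨ x) ∧ (z ∨ x⁻))⁻⁻
  -- = (z ∨ (x ∧ x⁻))⁻⁻ ≤ z ∨ ⊥.
  complement⇒least :
    (∀ {x y} → x ≤ y → y ⁻ ≤ x ⁻) → (∀ x → ⊤ ≤ x ∨ x ⁻) → (∀ x → x ⁻ ⁻ ≤ x) →
    ⊤ ⁻ ≤ ⊥ → (∀ x y → (x ∨ y) ⁻ ⁻ ≤ x ⁻ ⁻ ∨ y ⁻ ⁻) →
    ∀ {x z} → ⊤ ≤ x ∨ z → x ⁻ ≤ z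
  complement⇒least antitone complement deflationary ⊤⁻≤⊥ ⁻⁻-∨ {x} {z} ⊤≤x∨z =
    trans (antitone (deflationary x))
    (trans (antitone (antitone x⁻≤z∨[x∧x⁻]))
    (trans (⁻⁻-∨ z (x ∧ x ⁻))
    (∨-least (deflationary z)
      (trans (antitone ⊤≤[x∧x⁻]⁻) (trans ⊤⁻≤⊥ (minimum z))))))
    where
    x⁻≤z∨[x∧x⁻] : x ⁻ ≤ z ∨ (x ∧ x ⁻)
    x⁻≤z∨[x∧x⁻] = trans
      (∧-greatest (trans (maximum _) (trans ⊤≤x∨z (reflexive (∨-comm x z)))) (y≤x∨y z (x ⁻)))
      (reflexive (Eq.sym (∨-distribˡ-∧ z x (x ⁻))))
    ⊤≤[x∧x⁻]⁻ : ⊤ ≤ (x ∧ x ⁻) ⁻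
    ⊤≤[x∧x⁻]⁻ = trans (complement (x ⁻))
      (∨-least (antitone (x∧y≤x x (x ⁻))) (antitone (x∧y≤y x (x ⁻))))

-- The variety and Heyting algebras in the reversed order

module _ (A : Algebra c ℓ) where
  open Algebra A hiding (_≤_)

  -- The order is a parameter: it is derivability on the Lindenbaum algebra and the reversed `_≤_`
  -- on a member of the variety.
  IsHeytingAlgebraᵈ : Rel Carrier ℓ₂ → Set _
  IsHeytingAlgebraᵈ _≼_ = IsHeytingAlgebra _≈_ _≼_ _∧_ _∨_ _←_ 0# 1#

module FromHeyting (A : Algebra c ℓ) {_≼_ : Rel (Algebra.Carrier A) ℓ₂}
  (isHeyting : IsHeytingAlgebraᵈ A _≼_) where

  heytingAlgebra : HeytingAlgebra c ℓ ℓ₂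
  heytingAlgebra = record { isHeytingAlgebra = isHeyting }

  open Algebra A
  private
    module H = HeytingLemmas heytingAlgebra
    module P = DistributiveLatticeProperties H.distributiveLattice
    module L = LatticeProperties H.lattice

  ≽⇒≤ : ∀ {x y} → y ≼ x → x ≤ y
  ≽⇒≤ y≼x = H.antisym (H.x≤x∨y _ _) (H.∨-least H.refl y≼x)

  ≤⇒≽ : ∀ {x y} → x ≤ y → y ≼ x
  ≤⇒≽ x≈x∧y = H.trans (H.y≤x∨y _ _) (H.reflexive (H.Eq.sym x≈x∧y))

  isRPCHᵈ : IsRegularDualPseudocomplement heytingAlgebra _* → IsRPCHᵈ A
  isRPCHᵈ isRegular = record
    { isDistributiveLattice = AlgDistributiveLattice.∧-∨-isDistributiveLattice (record
        { isDistributiveLattice = record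
          { isLattice   = L.isAlgLattice
          ; ∨-distrib-∧ = P.∨-distrib-∧
          ; ∧-distrib-∨ = P.∧-distrib-∨
          }
        })
    ; 0-minimum  = λ x → ≽⇒≤ (H.maximum x)
    ; 1-maximum  = λ x → ≽⇒≤ (H.minimum x)
    ; *-greatest = λ x →
        H.antisym (H.maximum _) (⁻-complement x) ,
        λ z x∧z≈0 → ≽⇒≤ (⁻-least (H.reflexive (H.Eq.sym x∧z≈0)))
    ; ←-least    = λ x y →
        ≽⇒≤ (H.trans (H.reflexive (H.∧-comm _ _)) H.⇨-eval) ,
        λ z y≤x∨z → ≽⇒≤ (H.transpose-⇨ (H.trans (H.reflexive (H.∧-comm _ _)) (≤⇒≽ y≤x∨z)))
    -- Reversing the order swaps the two sides of the inequality, hence the exchanged arguments.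
    ; regular    = λ x y → H.antisym (H.x∧y≤y _ _) (H.∧-greatest (regular y x) H.refl)
    }
    where open IsRegularDualPseudocomplement isRegular

module ToHeyting (A : Algebra c ℓ) (isRPCHᵈ : A ∈ IsRPCHᵈ) where
  open Algebra A
  open IsRPCHᵈ isRPCHᵈ

  private
    lattice : Lattice c ℓ ℓ
    lattice = AlgDistributiveLattice.∨-∧-orderTheoreticLattice
      (record { isDistributiveLattice = isDistributiveLattice })

    module L = Lattice lattice

  isHeytingᵈ : IsHeytingAlgebraᵈ A (flip _≤_)
  isHeytingᵈ = record
    { isBoundedLattice = record
      { isLattice = LatticeProperties.∧-∨-isLattice lattice
      ; maximum   = 0-minimum
      ; minimum   = 1-maximum
      }
    ; exponential = λ w x y →
        (λ y≤w∨x → proj₂ (←-least x y) w (L.trans y≤w∨x (∨-swap w x))) ,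
        (λ x←y≤w → L.trans (proj₁ (←-least x y))
          (L.∨-least (L.y≤x∨y w x) (L.trans x←y≤w (L.x≤x∨y w x))))
    }
    where
    ∨-swap : ∀ x y → (x ∨ y) ≤ (y ∨ x)
    ∨-swap x y = L.∨-least (L.y≤x∨y y x) (L.x≤x∨y y x)

  heytingAlgebra : HeytingAlgebra c ℓ ℓ
  heytingAlgebra = record { isHeytingAlgebra = isHeytingᵈ }

  isRegularDualPseudocomplement : IsRegularDualPseudocomplement heytingAlgebra _*
  isRegularDualPseudocomplement = record
    { ⁻-complement = λ x → L.reflexive (proj₁ (*-greatest x))
    ; ⁻-least      = λ {x} {z} x∧z≤0 → proj₂ (*-greatest x) z (L.antisym x∧z≤0 (0-minimum _))
    ; regular      = λ x y → L.trans (L.x≤x∨y _ _) (L.reflexive (regular y x))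
    }

-- Soundness

module Soundness (A : Algebra c ℓ) (isRPCHᵈ : A ∈ IsRPCHᵈ) where
  private module A = Algebra A
  open A using (⟦_⟧; 0#)
  open ToHeyting A isRPCHᵈ
  open HeytingLemmas heytingAlgebra
  open DualPseudocomplementLemmas heytingAlgebra isRegularDualPseudocomplement
  private
    module ⇛ where
      open HeytingAlgebra ⇛-heytingAlgebra public using (transpose-⇨; transpose-∧)
      open HeytingProperties ⇛-heytingAlgebra public

  -- Moves a substitution into the valuation, so that validity of an axiom at every valuation covers
  -- all its instances.
  ⟦[]⟧ : ∀ (φ : Formula V) (σ : V → Formula W) v → ⟦ φ [ σ ] ⟧ v ≡ ⟦ φ ⟧ (λ x → ⟦ σ x ⟧ v)
  ⟦[]⟧ (RPCHᵈ.var x) σ v = ≡.refl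
  ⟦[]⟧ (φ RPCHᵈ.∨ ψ) σ v = ≡.cong₂ A._∨_ (⟦[]⟧ φ σ v) (⟦[]⟧ ψ σ v)
  ⟦[]⟧ (φ RPCHᵈ.∧ ψ) σ v = ≡.cong₂ A._∧_ (⟦[]⟧ φ σ v) (⟦[]⟧ ψ σ v)
  ⟦[]⟧ (φ RPCHᵈ.← ψ) σ v = ≡.cong₂ A._←_ (⟦[]⟧ φ σ v) (⟦[]⟧ ψ σ v)
  ⟦[]⟧ (RPCHᵈ.∼ φ)   σ v = ≡.cong A._* (⟦[]⟧ φ σ v)
  ⟦[]⟧ RPCHᵈ.⊥       σ v = ≡.refl
  ⟦[]⟧ RPCHᵈ.⊤       σ v = ≡.refl

  Valid : (ℕ → A.Carrier) → Fm → Set ℓ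
  Valid v φ = ⊤ ≤ ⟦ φ ⟧ v

  -- From y and `y ⇛ x` one gets x, and then z from `x ⇨ z`.
  ⇨-replaceˡ : ∀ x y z → (x ⇛ y) ≤ (y ⇛ x) ⇛ ((x ⇨ z) ⇛ (y ⇨ z))
  ⇨-replaceˡ x y z = ⇛.transpose-⇨ (⇛.transpose-⇨ (transpose-⇨ (trans
    (∧-greatest
      (trans (x∧y≤x _ _) (x∧y≤y _ _))
      (trans (∧-monotonic (trans (x∧y≤x _ _) (x∧y≤y _ _)) refl) ⇛.⇨-eval))
    ⇨-eval)))

  ⇨-replaceʳ : ∀ x y z → (x ⇛ y) ≤ (y ⇛ x) ⇛ ((z ⇨ y) ⇛ (z ⇨ x))
  ⇨-replaceʳ x y z = ⇛.transpose-⇨ (⇛.transpose-⇨ (transpose-⇨ (trans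
    (∧-greatest
      (trans (x∧y≤x _ _) (trans (x∧y≤x _ _) (x∧y≤y _ _)))
      (trans (∧-monotonic (x∧y≤y _ _) refl) ⇨-eval))
    ⇛.⇨-eval)))

  -- The value of `dual φ` computes to the value of φ in the reversed Heyting algebra, with `⟶ᴴ`
  -- read as `_⇛_`. Each entry therefore proves the undualized axiom.
  axioms-valid : ∀ v → All (Valid v) (dualSystem RDPCH-system .axioms)
  axioms-valid v =
      ⊤≤⇛ (x≤x∨y _ _)
    ∷ ⊤≤⇛ (y≤x∨y _ _)
    ∷ ⊤≤⇛ (⇛.transpose-⇨ (⇛.⇨-distribˡ-∨-∧-≥ _ _ _))
    ∷ ⊤≤⇛ (x∧y≤x _ _)
    ∷ ⊤≤⇛ (⇛.transpose-⇨ (⇛.⇨-distribˡ-∧-≥ _ _ _))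
    ∷ refl
    ∷ ⊤≤⇛ (minimum _)
    ∷ ⊤≤⇛ (reflexive ⇛.⇨-curry)
    ∷ ⊤≤⇛ (reflexive (Eq.sym ⇛.⇨-curry))
    ∷ ⊤≤⇛ (⇨-replaceˡ _ _ _)
    ∷ ⊤≤⇛ (⇨-replaceʳ _ _ _)
    ∷ ⊤≤⇛ ⊤≤⊥⁻
    ∷ ⊤≤⇛ ⊤⁻≤⊥
    ∷ ⊤≤⇛ (⁻-∧ _ _)
    -- Axiom 15 is the implication whose outermost arrow is not `⟶ᴴ`, so `_⇨_` itself is transposed.
    ∷ transpose-⇨ (trans (x∧y≤y _ _) (x∧y≤x _ _))
    ∷ ⊤≤⇛ (maximum _)
    ∷ ∧-greatest (⊤≤⇛ (⁻⁻-∨ _ _))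
                 (⊤≤⇛ (∨-least (⁻-antitone (⁻-antitone (x≤x∨y _ _)))
                               (⁻-antitone (⁻-antitone (y≤x∨y _ _)))))
    ∷ ∧-greatest (⊤≤⇛ (∨-least (⁻⁻-deflationary _) refl)) (⊤≤⇛ (y≤x∨y _ _))
    ∷ ⁻-complement _
    ∷ ∧-greatest (⊤≤⇛ (∨-least (regular _ _) refl)) (⊤≤⇛ (y≤x∨y _ _))
    ∷ []

  rules-valid : ∀ v → All (λ (ps , q) → All (Valid v) ps → Valid v q) (dualSystem RDPCH-system .rules)
  rules-valid v =
      (λ { (p ∷ p⇛q ∷ []) → trans p (⊤≤⇛⁻¹ p⇛q) })
    ∷ (λ { (p⇛q ∷ []) → ⊤≤⇛ (⁻-antitone (⊤≤⇛⁻¹ p⇛q)) })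
    ∷ []

  module _ {Γ : Pred Fm g} (v : ℕ → A.Carrier) (Γ-valid : ∀ {ψ} → ψ ∈ Γ → Valid v ψ) where

    sound  : ∀ {φ} → Γ ⊢ φ → Valid v φ
    sounds : ∀ {ps} (σ : ℕ → Fm) → All (λ p → Γ ⊢ p [ σ ]) ps → All (Valid (λ x → ⟦ σ x ⟧ v)) ps

    sound (premise φ∈Γ)             = Γ-valid φ∈Γ
    sound (axiom {φ} φ∈axioms σ)    = ≡.subst (⊤ ≤_) (≡.sym (⟦[]⟧ φ σ v))
      (All.lookup (axioms-valid _) φ∈axioms)
    sound (rule {q = q} r∈rules σ ds) = ≡.subst (⊤ ≤_) (≡.sym (⟦[]⟧ q σ v))
      (All.lookup (rules-valid _) r∈rules (sounds σ ds))

    sounds         σ []       = []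
    sounds {p ∷ _} σ (d ∷ ds) = ≡.subst (⊤ ≤_) (⟦[]⟧ p σ v) (sound d) ∷ sounds σ ds

  ⊤≤⇒≈0 : ∀ {x} → ⊤ ≤ x → x A.≈ 0#
  ⊤≤⇒≈0 ⊤≤x = antisym (maximum _) ⊤≤x

  ≈0⇒⊤≤ : ∀ {x} → x A.≈ 0# → ⊤ ≤ x
  ≈0⇒⊤≤ x≈0 = reflexive (Eq.sym x≈0)

  -- Together with `⇛≈0⇒≈` this is condition (B): the two equivalence formulas encode the two halves
  -- of antisymmetry.
  ≈⇒⇛≈0 : ∀ {x y} → x A.≈ y → x ⇛ y A.≈ 0#
  ≈⇒⇛≈0 x≈y = ⊤≤⇒≈0 (⊤≤⇛ (reflexive x≈y))

  ⇛≈0⇒≈ : ∀ {x y} → x ⇛ y A.≈ 0# → y ⇛ x A.≈ 0# → x A.≈ y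
  ⇛≈0⇒≈ p q = antisym (⊤≤⇛⁻¹ (≈0⇒⊤≤ p)) (⊤≤⇛⁻¹ (≈0⇒⊤≤ q))

-- Derivations in the dual calculus

module Derivations (Γ : Pred Fm g) where
  open RPCHᵈ using (_∨_; _∧_; _←_; ∼_; ⊥; ⊤)

  infixr 5 _⇒_
  infix  4 _≼_ _≈_

  _⇒_ : Fm → Fm → Fm
  φ ⇒ ψ = φ ← φ ∨ ψ

  _≼_ : Rel Fm _
  φ ≼ ψ = Γ ⊢ φ ⇒ ψ

  private variable
    φ ψ χ ω : Fm

  -- Axioms and rules mention only the variables 0, 1 and 2, so the last clause doubles as a
  -- default. Slots of variables absent from a given axiom or rule receive an arbitrary filler.
  ⟨_,_,_⟩ : Fm → Fm → Fm → ℕ → Fm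
  ⟨ φ , ψ , χ ⟩ 0 = φ
  ⟨ φ , ψ , χ ⟩ 1 = ψ
  ⟨ φ , ψ , χ ⟩ _ = χ

  -- Indices start at 0, so that axiom# (# i) is axiom i + 1.
  axiom# : (i : Fin 20) (φ ψ χ : Fm) →
           Γ ⊢ lookup (dualSystem RDPCH-system .axioms) i [ ⟨ φ , ψ , χ ⟩ ]
  axiom# i φ ψ χ = axiom (∈-lookup i) ⟨ φ , ψ , χ ⟩

  ⊢⊥ : Γ ⊢ ⊥
  ⊢⊥ = axiom# (# 5) ⊥ ⊥ ⊥

  modus-ponens : Γ ⊢ φ → φ ≼ ψ → Γ ⊢ ψ
  modus-ponens {φ} {ψ} d e = rule (here ≡.refl) ⟨ φ , φ , ψ ⟩ (d ∷ e ∷ [])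

  ∼-antitone : φ ≼ ψ → ∼ ψ ≼ ∼ φ
  ∼-antitone {φ} {ψ} d = rule (there (here ≡.refl)) ⟨ φ , φ , ψ ⟩ (d ∷ [])

  φ≼φ∧ψ : ∀ φ ψ → φ ≼ φ ∧ ψ
  φ≼φ∧ψ φ ψ = axiom# (# 0) φ ψ ⊥

  ψ≼φ∧ψ : ∀ φ ψ → ψ ≼ φ ∧ ψ
  ψ≼φ∧ψ φ ψ = axiom# (# 1) φ ψ ⊥

  ∧-least : φ ≼ χ → ψ ≼ χ → φ ∧ ψ ≼ χ
  ∧-least {φ} {χ} {ψ} d e = modus-ponens e (modus-ponens d (axiom# (# 2) φ ψ χ))

  φ∨ψ≼φ : ∀ φ ψ → φ ∨ ψ ≼ φ
  φ∨ψ≼φ φ ψ = axiom# (# 3) φ ψ ⊥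

  ∨-greatest : χ ≼ φ → χ ≼ ψ → χ ≼ φ ∨ ψ
  ∨-greatest {χ} {φ} {ψ} d e = modus-ponens e (modus-ponens d (axiom# (# 4) φ ψ χ))

  curry : φ ∨ ψ ≼ χ → φ ≼ ψ ⇒ χ
  curry {φ} {ψ} {χ} d = modus-ponens d (axiom# (# 7) φ ψ χ)

  uncurry : φ ≼ ψ ⇒ χ → φ ∨ ψ ≼ χ
  uncurry {φ} {ψ} {χ} d = modus-ponens d (axiom# (# 8) φ ψ χ)

  ←-replaceˡ : φ ≼ ψ → ψ ≼ φ → Γ ⊢ φ ← χ → Γ ⊢ ψ ← χ
  ←-replaceˡ {φ} {ψ} {χ} d e f =
    modus-ponens f (modus-ponens e (modus-ponens d (axiom# (# 9) φ ψ χ)))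

  ←-replaceʳ : φ ≼ ψ → ψ ≼ φ → Γ ⊢ χ ← φ → Γ ⊢ χ ← ψ
  ←-replaceʳ {φ} {ψ} {χ} d e f =
    -- Axiom 11 replaces its β by its α, whence the swapped instance.
    modus-ponens f (modus-ponens d (modus-ponens e (axiom# (# 10) ψ φ χ)))

  weaken : Γ ⊢ ψ → φ ≼ ψ
  weaken {ψ} {φ} d = modus-ponens d (curry (φ∨ψ≼φ ψ φ))

  -- Axiom 4 projects to the left component only. Uncurrying a weakened derivation handles the right
  -- one before reflexivity and transitivity are available.
  ∨-weakenˡ : φ ≼ ψ → χ ∨ φ ≼ ψ
  ∨-weakenˡ d = uncurry (weaken d)

  ∼∼φ∧φ≼φ : ∀ φ → ∼ ∼ φ ∧ φ ≼ φ
  ∼∼φ∧φ≼φ φ = modus-ponens (axiom# (# 17) φ ⊥ ⊥) (φ∨ψ≼φ _ _)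

  -- Reflexivity at a meet follows from the axioms for ∧; axiom 18 says that
  -- every formula is equivalent to such a meet.
  ≼-refl : φ ≼ φ
  ≼-refl {φ} =
    ←-replaceʳ (∨-greatest (∨-weakenˡ down) (∨-weakenˡ down))
               (∨-greatest (∨-weakenˡ up) (∨-weakenˡ up))
    (←-replaceˡ down up (∧-least (φ≼φ∧ψ (∼ ∼ φ) φ) up))
    where
    down = ∼∼φ∧φ≼φ φ
    up   = ψ≼φ∧ψ (∼ ∼ φ) φ

  φ∨ψ≼ψ : ∀ φ ψ → φ ∨ ψ ≼ ψ
  φ∨ψ≼ψ φ ψ = ∨-weakenˡ ≼-refl

  ∨-swap : ∀ φ ψ → φ ∨ ψ ≼ ψ ∨ φ
  ∨-swap φ ψ = ∨-greatest (φ∨ψ≼ψ φ ψ) (φ∨ψ≼φ φ ψ)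

  ∨-monoʳ : φ ≼ ψ → χ ∨ φ ≼ χ ∨ ψ
  ∨-monoʳ d = ∨-greatest (φ∨ψ≼φ _ _) (∨-weakenˡ d)

  -- If φ ≼ ψ then φ is equivalent to φ ∨ ψ, which by weakening lies below χ.
  ≼-trans : φ ≼ ψ → ψ ≼ χ → φ ≼ χ
  ≼-trans {φ} {ψ} {χ} d e =
    ←-replaceʳ (∨-swap χ φ) (∨-swap φ χ)
    (←-replaceʳ (∨-monoʳ φ∨ψ≼φ′) (∨-monoʳ φ≼φ∨ψ)
    (←-replaceʳ (∨-swap _ χ) (∨-swap χ _)
    (←-replaceˡ φ∨ψ≼φ′ φ≼φ∨ψ (∨-weakenˡ e))))
    where
    φ∨ψ≼φ′ = φ∨ψ≼φ φ ψ
    φ≼φ∨ψ  = ∨-greatest ≼-refl d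

  -- Modus ponens under the assumption φ; chains of it stand in for a deduction theorem.
  apply : φ ≼ ψ ⇒ χ → φ ≼ ψ → φ ≼ χ
  apply d e = ≼-trans (∨-greatest ≼-refl e) (uncurry d)

  -- Given φ, ψ is equivalent to φ ∨ ψ.
  ←≼⇒ : ∀ φ ψ → φ ← ψ ≼ φ ⇒ ψ
  ←≼⇒ φ ψ = curry (apply (apply
    (≼-trans (φ∨ψ≼ψ (φ ← ψ) φ) (apply (apply
      (weaken (axiom# (# 10) (φ ∨ ψ) ψ φ))
      (curry (∨-weakenˡ (φ∨ψ≼ψ φ ψ))))
      (curry ≼-refl)))
    (φ∨ψ≼φ (φ ← ψ) φ)) (φ∨ψ≼ψ (φ ← ψ) φ))

  -- Given φ ⇒ ψ, φ is equivalent to ψ ∨ φ, and axiom 15 gives (ψ ∨ φ) ← ψ.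
  ⇒≼← : ∀ φ ψ → φ ⇒ ψ ≼ φ ← ψ
  ⇒≼← φ ψ = apply (apply (apply
    (weaken (axiom# (# 9) (ψ ∨ φ) φ ψ))
    (weaken (φ∨ψ≼ψ ψ φ)))
    (curry (∨-greatest (uncurry ≼-refl) (φ∨ψ≼ψ _ φ))))
    (weaken (axiom# (# 14) ψ φ ⊥))

  ←-transpose : φ ∨ ψ ≼ χ → φ ≼ ψ ← χ
  ←-transpose d = ≼-trans (curry d) (⇒≼← _ _)

  ←-untranspose : φ ≼ ψ ← χ → φ ∨ ψ ≼ χ
  ←-untranspose d = uncurry (≼-trans d (←≼⇒ _ _))

  -- The Lindenbaum algebra and completeness

  _≈_ : Rel Fm _
  φ ≈ ψ = φ ≼ ψ × ψ ≼ φ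

  -- The carrier is lifted because the class may consist of algebras with carriers at any level c.
  -- The level of the equality is that of Γ.
  lindenbaum : (c : Level) → Algebra c _
  lindenbaum c = record
    { Carrier       = Lift c Fm
    ; _≈_           = λ a b → lower a ≈ lower b
    ; isEquivalence = record
      { refl  = ≼-refl , ≼-refl
      ; sym   = swap
      ; trans = λ (d , e) (d′ , e′) → ≼-trans d d′ , ≼-trans e′ e
      }
    ; _∨_           = λ a b → lift (lower a ∨ lower b)
    ; _∧_           = λ a b → lift (lower a ∧ lower b)
    ; _←_           = λ a b → lift (lower a ← lower b)
    ; _*            = λ a → lift (∼ lower a)
    ; 0#            = lift ⊥
    ; 1#            = lift ⊤
    ; ∨-cong        = λ (d , e) (d′ , e′) → ∨-mono d d′ , ∨-mono e e′
    ; ∧-cong        = λ (d , e) (d′ , e′) → ∧-mono d d′ , ∧-mono e e′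
    ; ←-cong        = λ (d , e) (d′ , e′) → ←-mono e d′ , ←-mono d e′
    ; *-cong        = λ (d , e) → ∼-antitone e , ∼-antitone d
    }
    where
    ∨-mono : φ ≼ ψ → χ ≼ ω → φ ∨ χ ≼ ψ ∨ ω
    ∨-mono d e = ∨-greatest (≼-trans (φ∨ψ≼φ _ _) d) (≼-trans (φ∨ψ≼ψ _ _) e)
    ∧-mono : φ ≼ ψ → χ ≼ ω → φ ∧ χ ≼ ψ ∧ ω
    ∧-mono d e = ∧-least (≼-trans d (φ≼φ∧ψ _ _)) (≼-trans e (ψ≼φ∧ψ _ _))
    ←-mono : ψ ≼ φ → χ ≼ ω → φ ← χ ≼ ψ ← ω
    -- After transposing: `(φ ← χ) ∨ ψ ≼ (φ ← χ) ∨ φ ≼ χ ≼ ω`.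
    ←-mono d e = ←-transpose (≼-trans (∨-monoʳ d) (≼-trans (←-untranspose ≼-refl) e))

  lindenbaum-isHeytingᵈ : (c : Level) → IsHeytingAlgebraᵈ (lindenbaum c) (λ a b → lower a ≼ lower b)
  lindenbaum-isHeytingᵈ c = record
    { isBoundedLattice = record
      { isLattice = record
        { isPartialOrder = record
          { isPreorder = record
            { isEquivalence = Algebra.isEquivalence (lindenbaum c)
            ; reflexive     = proj₁
            ; trans         = ≼-trans
            }
          ; antisym    = _,_
          }
        ; supremum = λ _ _ → φ≼φ∧ψ _ _ , ψ≼φ∧ψ _ _ , λ _ → ∧-least
        ; infimum  = λ _ _ → φ∨ψ≼φ _ _ , φ∨ψ≼ψ _ _ , λ _ → ∨-greatest
        }
      ; maximum   = λ _ → weaken ⊢⊥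
      ; minimum   = λ a → axiom# (# 6) (lower a) ⊥ ⊥
      }
    ; exponential = λ _ _ _ → ←-transpose , ←-untranspose
    }

  -- No axiom states leastness of `∼`; `complement⇒least` recovers it from the rule (CP) and axioms
  -- 13, 17, 18 and 19. Regularity is the last axiom.
  lindenbaum-isRPCHᵈ : (c : Level) → lindenbaum c ∈ IsRPCHᵈ
  lindenbaum-isRPCHᵈ c = isRPCHᵈ (record
    { ⁻-complement = complement
    ; ⁻-least      = complement⇒least heytingAlgebra _*
        ∼-antitone complement (λ a → ≼-trans (φ≼φ∧ψ _ _) (∼∼φ∧φ≼φ (lower a)))
        (axiom# (# 12) ⊥ ⊥ ⊥)
        (λ a b → modus-ponens (axiom# (# 16) (lower a) (lower b) ⊥) (φ∨ψ≼φ _ _))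
    ; regular      = λ a b → ≼-trans (φ≼φ∧ψ _ _)
        (modus-ponens (axiom# (# 19) (lower a) (lower b) ⊥) (φ∨ψ≼φ _ _))
    })
    where
    open Algebra (lindenbaum c) using (_*)
    open FromHeyting (lindenbaum c) (lindenbaum-isHeytingᵈ c)
    complement = λ a → weaken (axiom# (# 18) (lower a) ⊥ ⊥)

  ⟦⟧-lindenbaum : ∀ φ → Algebra.⟦_⟧ (lindenbaum c) φ (λ x → lift (RPCHᵈ.var x)) ≡ lift φ
  ⟦⟧-lindenbaum (RPCHᵈ.var x) = ≡.refl
  ⟦⟧-lindenbaum (φ ∨ ψ)       =
    ≡.cong₂ (λ a b → lift (lower a ∨ lower b)) (⟦⟧-lindenbaum φ) (⟦⟧-lindenbaum ψ)
  ⟦⟧-lindenbaum (φ ∧ ψ)       =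
    ≡.cong₂ (λ a b → lift (lower a ∧ lower b)) (⟦⟧-lindenbaum φ) (⟦⟧-lindenbaum ψ)
  ⟦⟧-lindenbaum (φ ← ψ)       =
    ≡.cong₂ (λ a b → lift (lower a ← lower b)) (⟦⟧-lindenbaum φ) (⟦⟧-lindenbaum ψ)
  ⟦⟧-lindenbaum (∼ φ)         = ≡.cong (λ a → lift (∼ lower a)) (⟦⟧-lindenbaum φ)
  ⟦⟧-lindenbaum ⊥             = ≡.refl
  ⟦⟧-lindenbaum ⊤             = ≡.refl

  -- Under the canonical valuation each ψ in Γ is equivalent to the derivable `⊥`, so Θ holds. Hence
  -- so does `φ ≈ ⊥`, and modus ponens from `⊥` gives φ.
  complete : {Θ : Pred (Identity ℕ) ℓ} → (∀ {d} → d ∈ Θ → ∃[ ψ ] (ψ ∈ Γ × d ≡ (ψ , ⊥))) →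
             Θ ⊨[ IsRPCHᵈ {c = c} ] (φ , ⊥) → Γ ⊢ φ
  complete {c = c} {φ = φ} Θ⊆Γ≈⊥ Θ⊨φ = modus-ponens ⊢⊥ (proj₂ φ≈⊥)
    where
    φ≈⊥ : φ ≈ ⊥
    φ≈⊥ = ≡.subst (λ a → lower a ≈ ⊥) (⟦⟧-lindenbaum φ)
      (Θ⊨φ (lindenbaum c) (lindenbaum-isRPCHᵈ c) (λ x → lift (RPCHᵈ.var x)) λ d∈Θ →
        case Θ⊆Γ≈⊥ d∈Θ of λ { (ψ , ψ∈Γ , ≡.refl) →
          ≡.subst (λ a → lower a ≈ ⊥) (≡.sym (⟦⟧-lindenbaum ψ))
            (weaken ⊢⊥ , weaken (premise ψ∈Γ)) })

-- Algebraizability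

corollary3p10 : (c ℓ : Level) → IsEquivalentAlgebraicSemantics (_⊢_ {g = ℓ}) (IsRPCHᵈ {c = c} {ℓ = ℓ})
corollary3p10 c ℓ = record
  { definingIdentities  = (var 0F , ⊥) ∷ []
  ; equivalenceFormulas = (var 0F ← var 0F ∨ var 1F) ∷ (var 1F ← var 1F ∨ var 0F) ∷ []
  ; ⊢⇔⊨ = λ Γ φ → mk⇔
      (λ { Γ⊢φ (here ≡.refl) A isRPCHᵈ v Γ≈0 →
        Soundness.⊤≤⇒≈0 A isRPCHᵈ (Soundness.sound A isRPCHᵈ v
          (λ ψ∈Γ → Soundness.≈0⇒⊤≤ A isRPCHᵈ (Γ≈0 (_ , _ , here ≡.refl , ψ∈Γ , ≡.refl)))
          Γ⊢φ) })
      (λ Γ⊨φ → Derivations.complete Γ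
        (λ { (_ , _ , here ≡.refl , ψ∈Γ , ≡.refl) → _ , ψ∈Γ , ≡.refl })
        (Γ⊨φ (here ≡.refl)))
  ; ≈⇒equivalence = λ
      { φ ψ (_ , _ , here ≡.refl , here ≡.refl , ≡.refl) A isRPCHᵈ v φ≈ψ →
          Soundness.≈⇒⇛≈0 A isRPCHᵈ (φ≈ψ ≡.refl)
      ; φ ψ (_ , _ , here ≡.refl , there (here ≡.refl) , ≡.refl) A isRPCHᵈ v φ≈ψ →
          Soundness.≈⇒⇛≈0 A isRPCHᵈ (Algebra.isEquivalence A .IsEquivalence.sym (φ≈ψ ≡.refl))
      }
  ; equivalence⇒≈ = λ φ ψ A isRPCHᵈ v holds →
      Soundness.⇛≈0⇒≈ A isRPCHᵈ
        (holds (_ , _ , here ≡.refl , here ≡.refl , ≡.refl))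
        (holds (_ , _ , here ≡.refl , there (here ≡.refl) , ≡.refl))
  }
  where open RPCHᵈ using (var; _∨_; _←_; ⊥)
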